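{- Let $p>3$ be a prime number. Then $$\sum_{\substack{0\le k\le p-1\\ k\text{ even}}}k\,H_k\equiv\frac{1}{4}\left(H'_{p-1}-1\right)\pmod p .$$
   Context: $H_k=\sum_{j=1}^{k}\frac1j$ denotes the $k$-th harmonic number, with $H_0:=0$. For an odd prime $p$, $H'_{p-1}:=1+\frac13+\frac15+\dots+\frac1{p-2}$ is the sum of the reciprocals of the odd integers between $1$ and $p-2$. Congruences modulo $p$ are between rational numbers whose denominators are prime to $p$ (i.e. congruences in the localization $\mathbb{Z}_{(p)}$). -}

module Defs where

open import Data.Integer.Base using (+_)
open import Data.List.Base using (List; filter; foldr; map; upTo)
open import Data.Nat.Base using (ℕ; suc; _∸_)
open import Data.Nat.Coprimality using (Coprime)
open import Data.Nat.Divisibility using (_∣?_)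
open import Data.Product.Base using (_×_; ∃-syntax)
open import Data.Rational.Base using (ℚ; 0ℚ; _/_; _+_; _*_; _-_; ↧ₙ_)
open import Relation.Binary.PropositionalEquality using (_≡_)
open import Relation.Nullary.Decidable using (¬?)

fromℕ : ℕ → ℚ
fromℕ n = + n / 1

Σℚ : List ℕ → (ℕ → ℚ) → ℚ
Σℚ ks f = foldr _+_ 0ℚ (map f ks)

evensBelow : ℕ → List ℕ
evensBelow n = filter (2 ∣?_) (upTo n)

-- The reciprocals are indexed by i = j - 1, so that j = suc i is manifestly
-- nonzero.
H : ℕ → ℚ
H k = Σℚ (upTo k) (λ i → + 1 / suc i)

-- H′ n is the sum of 1/j over the odd j with 1 ≤ j ≤ n - 1; thus H′ (p ∸ 1)
-- is 1 + 1/3 + ... + 1/(p - 2) for an odd prime p.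
H′ : ℕ → ℚ
H′ n = Σℚ (filter (λ i → ¬? (2 ∣? suc i)) (upTo (n ∸ 1))) (λ i → + 1 / suc i)

-- Membership in the localization ℤ₍ₚ₎ ⊆ ℚ, for prime p; elements of ℚ are in
-- lowest terms.
_∈ℤ₍_₎ : ℚ → ℕ → Set
x ∈ℤ₍ p ₎ = Coprime (↧ₙ x) p

infix 4 _∈ℤ₍_₎ _≡_[mod_]

-- Congruence modulo the ideal p ℤ₍ₚ₎, including that both sides lie in ℤ₍ₚ₎.
_≡_[mod_] : ℚ → ℚ → ℕ → Set
x ≡ y [mod p ] =
  x ∈ℤ₍ p ₎ × y ∈ℤ₍ p ₎ × ∃[ z ] (z ∈ℤ₍ p ₎ × x - y ≡ fromℕ p * z)

{-# OPTIONS --safe #-}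
-- Write p = 2m + 1. Exchanging the two sums on the left gives the exact identity
--   Σ_{k ≤ 2m even} k H_k = m (m + 1) H_{2m} + (H′ - m (2m - 1)) / 4,
-- whose difference with (H′ - 1) / 4 is m (m + 1) H_{p-1} + p (1 - m) / 4. Finally
-- H_{p-1} ≡ 0 (mod p), because 1/j + 1/(p - j) = p / (j (p - j)).
module Submission where

open import Defs
open import Data.Integer.Base using (ℤ; +_)
import Data.Integer.Base as ℤ
import Data.Integer.Properties as ℤ
open import Data.List.Base using ([]; _∷_; [_]; applyUpTo; filter; foldr; map; upTo; _++_)
open import Data.List.Properties
  using (filter-++; filter-accept; filter-reject; map-cong-local; map-upTo; map-∘;
         upTo-∷ʳ; ++-identityʳ)
open import Data.List.Relation.Unary.All as All using (All; []; _∷_)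
open import Data.List.Relation.Unary.All.Properties using (all-upTo; filter⁺)
open import Data.Nat.Base using (ℕ; zero; suc; _<_; _∸_; NonZero; s≤s; z≤n)
import Data.Nat.Base as ℕ
open import Data.Nat.Coprimality as Coprimality
  using (Coprime; 1-coprimeTo; coprime-divisor; prime⇒coprime)
open import Data.Nat.Divisibility
  using (_∣_; _∣?_; divides; ∣-trans; ∣m+n∣m⇒∣n; ∣1⇒≡1; m∣m*n)
open import Data.Nat.Primality using (Prime; prime⇒irreducible)
import Data.Nat.Properties as ℕ
open import Data.Product.Base using (_,_; ∃-syntax)
open import Data.Rational.Base
  using (ℚ; mkℚ; 0ℚ; 1ℚ; ½; _/_; _+_; _*_; _-_; -_; ↧_)
open import Data.Rational.Properties
  using (normalize-coprime; ↧-/; ↧-+; ↧-*; ↧-neg; +-assoc; +-comm; +-identityˡ; +-identityʳ;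
         *-inverseʳ; *-zeroʳ; *-distribˡ-+)
open import Data.Rational.Solver using (module +-*-Solver)
open import Data.Sum.Base using (_⊎_; inj₁; inj₂)
open import Function.Base using (_∘_)
open import Level using (0ℓ)
open import Relation.Binary.PropositionalEquality
  using (_≡_; refl; sym; trans; cong; cong₂; subst; module ≡-Reasoning)
open import Relation.Nullary.Decidable using (¬?)
open import Relation.Nullary.Negation using (¬_; contradiction)
open import Relation.Unary using (Pred; Decidable)

open +-*-Solver using (solve; _:=_; _:+_; _:*_; _:-_; con)

private
  variable
    m n p : ℕ

  ¼ : ℚ
  ¼ = + 1 / 4

-- Natural numbers and their reciprocals in the rationals.

recip : ℕ → ℚ
recip i = + 1 / suc i

-- The gcd hidden in `+ n / 1` is stuck on a variable `n`; rewriting to the explicit fraction lets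
-- rational arithmetic compute.
fromℕ-mkℚ : ∀ n → fromℕ n ≡ mkℚ (+ n) 0 (Coprimality.sym (1-coprimeTo n))
fromℕ-mkℚ n = normalize-coprime (Coprimality.sym (1-coprimeTo n))

fromℕ-+ : ∀ m n → fromℕ (m ℕ.+ n) ≡ fromℕ m + fromℕ n
fromℕ-+ m n rewrite fromℕ-mkℚ m | fromℕ-mkℚ n =
  cong (_/ 1) (sym (cong₂ ℤ._+_ (ℤ.*-identityʳ (+ m)) (ℤ.*-identityʳ (+ n))))

fromℕ-*2 : ∀ m → fromℕ (m ℕ.* 2) ≡ fromℕ m + fromℕ m
fromℕ-*2 m = trans (cong fromℕ m*2≡m+m) (fromℕ-+ m m)
  where
  m*2≡m+m : m ℕ.* 2 ≡ m ℕ.+ m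
  m*2≡m+m = trans (ℕ.*-comm m 2) (cong (m ℕ.+_) (ℕ.+-identityʳ m))

fromℕ-suc*recip : ∀ n → fromℕ (suc n) * recip n ≡ 1ℚ
fromℕ-suc*recip n
  rewrite fromℕ-mkℚ (suc n) | normalize-coprime (1-coprimeTo (suc n)) =
  *-inverseʳ (mkℚ (+ suc n) 0 (Coprimality.sym (1-coprimeTo (suc n))))

-- Closure properties of the localization at `p`.

coprime-∣ : m ∣ n → Coprime n p → Coprime m p
coprime-∣ m∣n c (d∣m , d∣p) = c (∣-trans d∣m m∣n , d∣p)

-- A common divisor `d` of `m * n` and `p` is coprime to `m` because it divides `p`; by Euclid's
-- lemma it then divides `n`.
coprime-* : Coprime m p → Coprime n p → Coprime (m ℕ.* n) p
coprime-* {m} {p} c c′ {d} (d∣mn , d∣p) =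
  c′ (coprime-divisor d⊥m d∣mn , d∣p)
  where
  d⊥m : Coprime d m
  d⊥m (e∣d , e∣m) = c (e∣m , ∣-trans e∣d d∣p)

-- Fits `↧-/`, `↧-+` and `↧-*`, where the reduced denominator times a cancelled factor is the
-- unreduced one: reduction can only lose prime factors.
*≡⇒∣ : (i j k : ℤ) → i ℤ.* j ≡ k → ℤ.∣ i ∣ ∣ ℤ.∣ k ∣
*≡⇒∣ i j k eq = subst (ℤ.∣ i ∣ ∣_) (trans (sym (ℤ.abs-* i j)) (cong ℤ.∣_∣ eq)) (m∣m*n ℤ.∣ j ∣)

/-∈ : ∀ i n .{{_ : NonZero n}} → Coprime n p → i / n ∈ℤ₍ p ₎
/-∈ i n = coprime-∣ (*≡⇒∣ (↧ (i / n)) _ (+ n) (↧-/ i n))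

fromℕ-∈ : ∀ n → fromℕ n ∈ℤ₍ p ₎
fromℕ-∈ n = /-∈ (+ n) 1 (1-coprimeTo _)

+-∈ : ∀ x y → x ∈ℤ₍ p ₎ → y ∈ℤ₍ p ₎ → x + y ∈ℤ₍ p ₎
+-∈ x y c c′ =
  coprime-∣ (*≡⇒∣ (↧ (x + y)) _ (↧ x ℤ.* ↧ y) (↧-+ x y)) (coprime-* c c′)

*-∈ : ∀ x y → x ∈ℤ₍ p ₎ → y ∈ℤ₍ p ₎ → x * y ∈ℤ₍ p ₎
*-∈ x y c c′ =
  coprime-∣ (*≡⇒∣ (↧ (x * y)) _ (↧ x ℤ.* ↧ y) (↧-* x y)) (coprime-* c c′)

neg-∈ : ∀ x → x ∈ℤ₍ p ₎ → - x ∈ℤ₍ p ₎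
neg-∈ {p} x = subst (λ d → Coprime d p) (cong ℤ.∣_∣ (sym (↧-neg x)))

Σℚ-∈ : ∀ f {ks} → All (λ k → f k ∈ℤ₍ p ₎) ks → Σℚ ks f ∈ℤ₍ p ₎
Σℚ-∈ f []                = fromℕ-∈ 0
Σℚ-∈ f {k ∷ ks} (c ∷ cs) = +-∈ (f k) (Σℚ ks f) c (Σℚ-∈ f cs)

-- Finite sums.

module _ (f : ℕ → ℚ) where

  Σℚ-∷ʳ : ∀ ks k → Σℚ (ks ++ [ k ]) f ≡ Σℚ ks f + f k
  Σℚ-∷ʳ []       k = trans (+-identityʳ (f k)) (sym (+-identityˡ (f k)))
  Σℚ-∷ʳ (l ∷ ks) k = trans (cong (_+_ (f l)) (Σℚ-∷ʳ ks k)) (sym (+-assoc (f l) _ (f k)))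

  Σℚ-upTo-suc : ∀ n → Σℚ (upTo (suc n)) f ≡ Σℚ (upTo n) f + f n
  Σℚ-upTo-suc n = trans (cong (λ ks → Σℚ ks f) (sym (upTo-∷ʳ n))) (Σℚ-∷ʳ (upTo n) n)

  Σℚ-upTo-suc′ : ∀ n → Σℚ (upTo (suc n)) f ≡ f 0 + Σℚ (upTo n) (f ∘ suc)
  Σℚ-upTo-suc′ n = cong (λ xs → f 0 + foldr _+_ 0ℚ xs) (begin
    map f (applyUpTo suc n)  ≡⟨ cong (map f) (map-upTo suc n) ⟨
    map f (map suc (upTo n))                ≡⟨ map-∘ (upTo n) ⟨
    map (f ∘ suc) (upTo n)                  ∎)
    where open ≡-Reasoning

  Σℚ-*ˡ : ∀ c ks → Σℚ ks (λ k → c * f k) ≡ c * Σℚ ks f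
  Σℚ-*ˡ c []       = sym (*-zeroʳ c)
  Σℚ-*ˡ c (k ∷ ks) =
    trans (cong (_+_ (c * f k)) (Σℚ-*ˡ c ks)) (sym (*-distribˡ-+ c (f k) (Σℚ ks f)))

  module _ {P : Pred ℕ 0ℓ} (P? : Decidable P) where

    private
      filter-upTo-suc : ∀ n → filter P? (upTo (suc n)) ≡ filter P? (upTo n) ++ filter P? [ n ]
      filter-upTo-suc n = trans (cong (filter P?) (sym (upTo-∷ʳ n))) (filter-++ P? (upTo n) [ n ])

    Σℚ-filter-accept : P n →
      Σℚ (filter P? (upTo (suc n))) f ≡ Σℚ (filter P? (upTo n)) f + f n
    Σℚ-filter-accept {n} pn rewrite filter-upTo-suc n | filter-accept P? {xs = []} pn =
      Σℚ-∷ʳ (filter P? (upTo n)) n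

    Σℚ-filter-reject : ¬ P n →
      Σℚ (filter P? (upTo (suc n))) f ≡ Σℚ (filter P? (upTo n)) f
    Σℚ-filter-reject {n} ¬pn rewrite filter-upTo-suc n | filter-reject P? {xs = []} ¬pn =
      cong (λ ks → Σℚ ks f) (++-identityʳ (filter P? (upTo n)))

Σℚ-cong : ∀ {f g : ℕ → ℚ} {ks} → All (λ k → f k ≡ g k) ks → Σℚ ks f ≡ Σℚ ks g
Σℚ-cong eqs = cong (foldr _+_ 0ℚ) (map-cong-local eqs)

Σℚ-+ : ∀ f g ks → Σℚ ks (λ k → f k + g k) ≡ Σℚ ks f + Σℚ ks g
Σℚ-+ f g []       = refl
Σℚ-+ f g (k ∷ ks) = trans (cong (_+_ (f k + g k)) (Σℚ-+ f g ks))
  (solve 4 (λ a b c d → (a :+ b) :+ (c :+ d) := (a :+ c) :+ (b :+ d)) refl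
     (f k) (g k) (Σℚ ks f) (Σℚ ks g))

-- Induction that peels the first term off the reversed sum and the last term off the other; both
-- are `f n`.
Σℚ-reverse : ∀ f n → Σℚ (upTo n) (λ i → f (n ∸ suc i)) ≡ Σℚ (upTo n) f
Σℚ-reverse f zero    = refl
Σℚ-reverse f (suc n) = begin
  Σℚ (upTo (suc n)) (λ i → f (n ∸ i))         ≡⟨ Σℚ-upTo-suc′ (λ i → f (n ∸ i)) n ⟩
  f n + Σℚ (upTo n) (λ i → f (n ∸ suc i))     ≡⟨ cong (_+_ (f n)) (Σℚ-reverse f n) ⟩
  f n + Σℚ (upTo n) f                         ≡⟨ +-comm (f n) _ ⟩
  Σℚ (upTo n) f + f n                         ≡⟨ Σℚ-upTo-suc f n ⟨
  Σℚ (upTo (suc n)) f                         ∎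
  where open ≡-Reasoning

-- Divisibility of the harmonic number by pairing terms.

recip-pair : ∀ i j → recip i + recip j ≡ fromℕ (suc i ℕ.+ suc j) * (recip i * recip j)
recip-pair i j = sym (begin
  fromℕ (suc i ℕ.+ suc j) * (a * b)  ≡⟨ cong (_* (a * b)) (fromℕ-+ (suc i) (suc j)) ⟩
  (A + B) * (a * b)                  ≡⟨ solve 4 (λ A B a b → (A :+ B) :* (a :* b) := (B :* b) :* a :+ (A :* a) :* b)
                                          refl A B a b ⟩
  (B * b) * a + (A * a) * b          ≡⟨ cong₂ (λ u v → u * a + v * b) (fromℕ-suc*recip j) (fromℕ-suc*recip i) ⟩
  1ℚ * a + 1ℚ * b                    ≡⟨ solve 2 (λ a b → con 1ℚ :* a :+ con 1ℚ :* b := a :+ b) refl a b ⟩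
  a + b                              ∎)
  where
  open ≡-Reasoning
  A = fromℕ (suc i)
  B = fromℕ (suc j)
  a = recip i
  b = recip j

-- With j = i + 1 this is the sum of 1 / (j (n + 1 - j)) over 1 ≤ j ≤ n.
pairProducts : ℕ → ℚ
pairProducts n = Σℚ (upTo n) (λ i → recip i * recip (n ∸ suc i))

-- One copy of the sum is reversed, so that 1/j meets 1/(n + 1 - j).
H+H : ∀ n → H n + H n ≡ fromℕ (suc n) * pairProducts n
H+H n = begin
  H n + H n
    ≡⟨ cong (_+_ (H n)) (Σℚ-reverse recip n) ⟨
  H n + Σℚ (upTo n) (λ i → recip (n ∸ suc i))
    ≡⟨ Σℚ-+ recip (λ i → recip (n ∸ suc i)) (upTo n) ⟨
  Σℚ (upTo n) (λ i → recip i + recip (n ∸ suc i))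
    ≡⟨ Σℚ-cong (All.map pair (all-upTo n)) ⟩
  Σℚ (upTo n) (λ i → fromℕ (suc n) * (recip i * recip (n ∸ suc i)))
    ≡⟨ Σℚ-*ˡ (λ i → recip i * recip (n ∸ suc i)) (fromℕ (suc n)) (upTo n) ⟩
  fromℕ (suc n) * pairProducts n
    ∎
  where
  open ≡-Reasoning
  -- The bound on `i` makes the truncated subtraction exact, so the two denominators add up to
  -- `suc n`.
  pair : ∀ {i} → i < n → recip i + recip (n ∸ suc i) ≡ fromℕ (suc n) * (recip i * recip (n ∸ suc i))
  pair {i} i<n = trans (recip-pair i (n ∸ suc i))
    (cong (λ l → fromℕ l * (recip i * recip (n ∸ suc i)))
      (trans (ℕ.+-suc (suc i) (n ∸ suc i)) (cong suc (ℕ.m+[n∸m]≡n i<n))))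

-- For n = p - 1 this shows H_{p-1} ≡ 0 (mod p), since the cofactor has denominator prime to `p`.
H≡p*½pairs : ∀ n → H n ≡ fromℕ (suc n) * (½ * pairProducts n)
H≡p*½pairs n = begin
  H n                                   ≡⟨ solve 1 (λ h → h := con ½ :* (h :+ h)) refl (H n) ⟩
  ½ * (H n + H n)                       ≡⟨ cong (½ *_) (H+H n) ⟩
  ½ * (fromℕ (suc n) * pairProducts n)  ≡⟨ solve 3 (λ c P w → c :* (P :* w) := P :* (c :* w)) refl
                                             ½ (fromℕ (suc n)) (pairProducts n) ⟩
  fromℕ (suc n) * (½ * pairProducts n)  ∎
  where open ≡-Reasoning

-- The exact closed form of the sum over even indices.

2∣m*2 : ∀ m → 2 ∣ m ℕ.* 2
2∣m*2 m = divides m refl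

2∤1+m*2 : ∀ m → ¬ 2 ∣ suc (m ℕ.* 2)
2∤1+m*2 m 2∣ with () ← ∣1⇒≡1 (∣m+n∣m⇒∣n (subst (2 ∣_) (ℕ.+-comm 1 (m ℕ.* 2)) 2∣) (2∣m*2 m))

evenSum : ℕ → ℚ
evenSum n = Σℚ (evensBelow n) (λ k → fromℕ k * H k)

-- The bound of `evensBelow` is exclusive: the new indices are 2m + 1, which the filter drops, and
-- 2m + 2.
evenSum-suc : ∀ m → evenSum (suc (suc m ℕ.* 2)) ≡
  evenSum (suc (m ℕ.* 2)) + fromℕ (suc m ℕ.* 2) * H (suc m ℕ.* 2)
evenSum-suc m = trans
  (Σℚ-filter-accept kH (2 ∣?_) (2∣m*2 (suc m)))
  (cong (_+ kH (suc m ℕ.* 2)) (Σℚ-filter-reject kH (2 ∣?_) (2∤1+m*2 m)))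
  where
  kH : ℕ → ℚ
  kH k = fromℕ k * H k

H-suc-*2 : ∀ m → H (suc m ℕ.* 2) ≡ H (m ℕ.* 2) + recip (m ℕ.* 2) + recip (suc (m ℕ.* 2))
H-suc-*2 m = trans (Σℚ-upTo-suc recip (suc (m ℕ.* 2)))
  (cong (_+ recip (suc (m ℕ.* 2))) (Σℚ-upTo-suc recip (m ℕ.* 2)))

H′-suc-*2 : ∀ m → H′ (suc m ℕ.* 2) ≡ H′ (m ℕ.* 2) + recip (m ℕ.* 2)
-- Split off because the truncated `n ∸ 1` in `H′` reduces differently at `n = 0`; here both sides
-- evaluate to 1.
H′-suc-*2 zero    = refl
H′-suc-*2 (suc m) = trans
  (Σℚ-filter-accept recip odd? (2∤1+m*2 (suc m)))
  (cong (_+ recip (suc m ℕ.* 2))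
    (Σℚ-filter-reject recip odd? (λ odd → odd (2∣m*2 (suc m)))))
  where
  odd? = λ i → ¬? (2 ∣? suc i)

-- Induction on `m`: once the closed form for `m` is known, the step is a polynomial identity modulo
-- the two inverse relations for 2m + 1 and 2m + 2.
evenSum-closed : ∀ m → let M = fromℕ m in
  evenSum (suc (m ℕ.* 2)) ≡
  M * (M + 1ℚ) * H (m ℕ.* 2) + ¼ * (H′ (m ℕ.* 2) - M * (M + M - 1ℚ))
evenSum-closed zero    = refl
evenSum-closed (suc m) = begin
  evenSum (suc (suc m ℕ.* 2))
    ≡⟨ evenSum-suc m ⟩
  evenSum (suc (m ℕ.* 2)) + fromℕ (suc m ℕ.* 2) * H (suc m ℕ.* 2)
    ≡⟨ cong₂ _+_ (evenSum-closed m) (cong₂ _*_ B≡ (H-suc-*2 m)) ⟩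
  M * (M + 1ℚ) * h + ¼ * (o - M * (M + M - 1ℚ)) + (1ℚ + (1ℚ + (M + M))) * (h + a + b)
    -- The correction terms vanish by a (2m + 1) = 1 and b (2m + 2) = 1.
    ≡⟨ solve 5 (λ M h o a b →
         M :* (M :+ con 1ℚ) :* h :+ con ¼ :* (o :- M :* (M :+ M :- con 1ℚ))
           :+ (con 1ℚ :+ (con 1ℚ :+ (M :+ M))) :* (h :+ a :+ b)
         := (con 1ℚ :+ M) :* (con 1ℚ :+ M :+ con 1ℚ) :* (h :+ a :+ b)
           :+ con ¼ :* (o :+ a :- (con 1ℚ :+ M) :* (con 1ℚ :+ M :+ (con 1ℚ :+ M) :- con 1ℚ))
           :- con ¼ :* (con 1ℚ :+ (M :+ M)) :* ((con 1ℚ :+ (M :+ M)) :* a :- con 1ℚ)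
           :- con ½ :* M :* ((con 1ℚ :+ (con 1ℚ :+ (M :+ M))) :* b :- con 1ℚ))
         refl M h o a b ⟩
  R - ¼ * (1ℚ + (M + M)) * ((1ℚ + (M + M)) * a - 1ℚ)
    - ½ * M * ((1ℚ + (1ℚ + (M + M))) * b - 1ℚ)
    ≡⟨ cong₂ (λ u v → R - ¼ * (1ℚ + (M + M)) * (u - 1ℚ) - ½ * M * (v - 1ℚ)) a-inverse b-inverse ⟩
  R - ¼ * (1ℚ + (M + M)) * (1ℚ - 1ℚ) - ½ * M * (1ℚ - 1ℚ)
    -- `1ℚ - 1ℚ` computes to `0ℚ`, so the solver sees literal zeros.
    ≡⟨ solve 3 (λ R u v → R :- u :* con 0ℚ :- v :* con 0ℚ := R) refl R (¼ * (1ℚ + (M + M))) (½ * M) ⟩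
  R
    ≡⟨ cong₂ (λ u v → (1ℚ + M) * (1ℚ + M + 1ℚ) * u + ¼ * (v - (1ℚ + M) * (1ℚ + M + (1ℚ + M) - 1ℚ)))
         (H-suc-*2 m) (H′-suc-*2 m) ⟨
  (1ℚ + M) * (1ℚ + M + 1ℚ) * H (suc m ℕ.* 2)
    + ¼ * (H′ (suc m ℕ.* 2) - (1ℚ + M) * (1ℚ + M + (1ℚ + M) - 1ℚ))
    ≡⟨ cong (λ N → N * (N + 1ℚ) * H (suc m ℕ.* 2) + ¼ * (H′ (suc m ℕ.* 2) - N * (N + N - 1ℚ)))
         (fromℕ-+ 1 m) ⟨
  fromℕ (suc m) * (fromℕ (suc m) + 1ℚ) * H (suc m ℕ.* 2)
    + ¼ * (H′ (suc m ℕ.* 2) - fromℕ (suc m) * (fromℕ (suc m) + fromℕ (suc m) - 1ℚ))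
    ∎
  where
  open ≡-Reasoning
  M = fromℕ m
  h = H (m ℕ.* 2)
  o = H′ (m ℕ.* 2)
  a = recip (m ℕ.* 2)
  b = recip (suc (m ℕ.* 2))
  R = (1ℚ + M) * (1ℚ + M + 1ℚ) * (h + a + b)
    + ¼ * (o + a - (1ℚ + M) * (1ℚ + M + (1ℚ + M) - 1ℚ))

  A≡ : fromℕ (suc (m ℕ.* 2)) ≡ 1ℚ + (M + M)
  A≡ = trans (fromℕ-+ 1 (m ℕ.* 2)) (cong (_+_ 1ℚ) (fromℕ-*2 m))

  B≡ : fromℕ (suc m ℕ.* 2) ≡ 1ℚ + (1ℚ + (M + M))
  B≡ = trans (fromℕ-+ 1 (suc (m ℕ.* 2))) (cong (_+_ 1ℚ) A≡)

  a-inverse : (1ℚ + (M + M)) * a ≡ 1ℚ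
  a-inverse = trans (cong (_* a) (sym A≡)) (fromℕ-suc*recip (m ℕ.* 2))

  b-inverse : (1ℚ + (1ℚ + (M + M))) * b ≡ 1ℚ
  b-inverse = trans (cong (_* b) (sym B≡)) (fromℕ-suc*recip (suc (m ℕ.* 2)))

-- The `H′` terms cancel, and 1 - M (2M - 1) factors as (2M + 1) (1 - M); with H_{2m} also a
-- multiple of 2m + 1, that factor comes out of everything.
evenSum-difference : ∀ m → let M = fromℕ m in
  evenSum (suc (m ℕ.* 2)) - ¼ * (H′ (m ℕ.* 2) - 1ℚ) ≡
  fromℕ (suc (m ℕ.* 2)) * (M * (M + 1ℚ) * (½ * pairProducts (m ℕ.* 2)) + ¼ * (1ℚ - M))
evenSum-difference m = begin
  evenSum (suc (m ℕ.* 2)) - ¼ * (o - 1ℚ)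
    ≡⟨ cong (_- ¼ * (o - 1ℚ)) (evenSum-closed m) ⟩
  M * (M + 1ℚ) * H (m ℕ.* 2) + ¼ * (o - M * (M + M - 1ℚ)) - ¼ * (o - 1ℚ)
    ≡⟨ cong (λ h → M * (M + 1ℚ) * h + ¼ * (o - M * (M + M - 1ℚ)) - ¼ * (o - 1ℚ))
         (trans (H≡p*½pairs (m ℕ.* 2)) (cong (_* w) P≡)) ⟩
  M * (M + 1ℚ) * ((1ℚ + (M + M)) * w) + ¼ * (o - M * (M + M - 1ℚ)) - ¼ * (o - 1ℚ)
    ≡⟨ solve 3 (λ M o w →
         M :* (M :+ con 1ℚ) :* ((con 1ℚ :+ (M :+ M)) :* w)
           :+ con ¼ :* (o :- M :* (M :+ M :- con 1ℚ)) :- con ¼ :* (o :- con 1ℚ)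
         := (con 1ℚ :+ (M :+ M)) :* (M :* (M :+ con 1ℚ) :* w :+ con ¼ :* (con 1ℚ :- M)))
         refl M o w ⟩
  (1ℚ + (M + M)) * (M * (M + 1ℚ) * w + ¼ * (1ℚ - M))
    ≡⟨ cong (_* (M * (M + 1ℚ) * w + ¼ * (1ℚ - M))) P≡ ⟨
  fromℕ (suc (m ℕ.* 2)) * (M * (M + 1ℚ) * w + ¼ * (1ℚ - M))
    ∎
  where
  open ≡-Reasoning
  M = fromℕ m
  o = H′ (m ℕ.* 2)
  w = ½ * pairProducts (m ℕ.* 2)

  P≡ : fromℕ (suc (m ℕ.* 2)) ≡ 1ℚ + (M + M)
  P≡ = trans (fromℕ-+ 1 (m ℕ.* 2)) (cong (_+_ 1ℚ) (fromℕ-*2 m))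

-- Odd primes, integrality at `p`, and the congruence.

parity : ∀ n → ∃[ m ] (n ≡ m ℕ.* 2 ⊎ n ≡ suc (m ℕ.* 2))
parity zero = 0 , inj₁ refl
parity (suc n) with parity n
... | m , inj₁ n≡ = m , inj₂ (cong suc n≡)
... | m , inj₂ n≡ = suc m , inj₁ (cong suc n≡)

odd-prime : Prime p → 2 < p → ∃[ m ] p ≡ suc (m ℕ.* 2)
odd-prime {p} pr 2<p with parity p
... | m , inj₂ p≡ = m , p≡
-- Here 2 divides `p`, so irreducibility leaves only 2 = 1 or 2 = p.
... | m , inj₁ p≡ with prime⇒irreducible pr (divides m p≡)
...   | inj₁ ()
...   | inj₂ 2≡p = contradiction 2<p (ℕ.<-irrefl 2≡p)

recip-∈ : ∀ {i} → Prime p → suc i < p → recip i ∈ℤ₍ p ₎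
recip-∈ {i = i} pr i<p = /-∈ (+ 1) (suc i) (Coprimality.sym (prime⇒coprime pr i<p))

-- With p = n + 1, both j and p - j lie strictly between 0 and p, hence are prime to `p`.
pairProducts-∈ : ∀ n → Prime (suc n) → pairProducts n ∈ℤ₍ suc n ₎
pairProducts-∈ n pr = Σℚ-∈ (λ i → recip i * recip (n ∸ suc i)) (All.map pair-∈ (all-upTo n))
  where
  pair-∈ : ∀ {i} → i < n → recip i * recip (n ∸ suc i) ∈ℤ₍ suc n ₎
  pair-∈ {i} i<n = *-∈ (recip i) (recip (n ∸ suc i))
    (recip-∈ pr (s≤s i<n)) (recip-∈ {i = n ∸ suc i} pr (s≤s n∸1+i<n))
    where
    n∸1+i<n : n ∸ suc i < n
    n∸1+i<n = ℕ.∸-monoʳ-< (s≤s z≤n) i<n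

H′-∈ : ∀ n → Prime (suc n) → H′ n ∈ℤ₍ suc n ₎
H′-∈ n pr = Σℚ-∈ recip (filter⁺ (λ i → ¬? (2 ∣? suc i)) (All.map r-∈ (all-upTo (n ∸ 1))))
  where
  r-∈ : ∀ {i} → i < n ∸ 1 → recip i ∈ℤ₍ suc n ₎
  r-∈ i<n∸1 = recip-∈ pr (s≤s (ℕ.<-≤-trans i<n∸1 (ℕ.m∸n≤m n 1)))

-- Integrality of `x` comes for free from x = p z + y.
x-y≡pz⇒≡[mod] : ∀ {x y z} → y ∈ℤ₍ p ₎ → z ∈ℤ₍ p ₎ →
  x - y ≡ fromℕ p * z → x ≡ y [mod p ]
x-y≡pz⇒≡[mod] {p} {x} {y} {z} y∈ z∈ eq = x∈ , y∈ , z , z∈ , eq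
  where
  x∈ : x ∈ℤ₍ p ₎
  x∈ = subst (_∈ℤ₍ p ₎)
    (trans (cong (_+ y) (sym eq)) (solve 2 (λ x y → x :- y :+ y := x) refl x y))
    (+-∈ (fromℕ p * z) y (*-∈ (fromℕ p) z (fromℕ-∈ p) z∈) y∈)

corollary1 : (p : ℕ) → Prime p → 3 < p →
    Σℚ (evensBelow p) (λ k → fromℕ k * H k) ≡ (+ 1 / 4) * (H′ (p ∸ 1) - 1ℚ) [mod p ]
-- Matching on `refl` turns `p` into `suc (m * 2)`, so `p ∸ 1` reduces to `m * 2` and the exact
-- difference applies as it stands.
corollary1 p pr 3<p with m , refl ← odd-prime pr (ℕ.<-trans (ℕ.n<1+n 2) 3<p) =
  x-y≡pz⇒≡[mod] {x = evenSum p} y∈ z∈ (evenSum-difference m)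
  where
  M = fromℕ m
  w = pairProducts (m ℕ.* 2)

  2⊥p : Coprime 2 p
  2⊥p = Coprimality.sym (prime⇒coprime pr (ℕ.<-trans (ℕ.n<1+n 2) 3<p))

  -- The denominator 4 is 2 times 2; likewise `2⊥p` itself serves below as integrality of `½`.
  ¼∈ : ¼ ∈ℤ₍ p ₎
  ¼∈ = coprime-* 2⊥p 2⊥p

  y∈ : ¼ * (H′ (m ℕ.* 2) - 1ℚ) ∈ℤ₍ p ₎
  y∈ = *-∈ ¼ (H′ (m ℕ.* 2) - 1ℚ) ¼∈
    (+-∈ (H′ (m ℕ.* 2)) (- 1ℚ) (H′-∈ (m ℕ.* 2) pr) (neg-∈ 1ℚ (fromℕ-∈ 1)))

  -- This is the cofactor of `p` in `evenSum-difference`.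
  z∈ : M * (M + 1ℚ) * (½ * w) + ¼ * (1ℚ - M) ∈ℤ₍ p ₎
  z∈ = +-∈ (M * (M + 1ℚ) * (½ * w)) (¼ * (1ℚ - M))
    (*-∈ (M * (M + 1ℚ)) (½ * w)
      (*-∈ M (M + 1ℚ) (fromℕ-∈ m) (+-∈ M 1ℚ (fromℕ-∈ m) (fromℕ-∈ 1)))
      (*-∈ ½ w 2⊥p (pairProducts-∈ (m ℕ.* 2) pr)))
    (*-∈ ¼ (1ℚ - M) ¼∈ (+-∈ 1ℚ (- M) (fromℕ-∈ 1) (neg-∈ M (fromℕ-∈ m))))
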